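{- Let $G$ be an orientation of a graph with chromatic number $4$. Then $G$ has an acyclic subgraph with chromatic number at least $3$. In particular, $f(2)=3$.
   Context: All graphs are finite and simple. An oriented graph is an orientation of a simple undirected graph. The chromatic number of an oriented graph (or of a subgraph of it) is the chromatic number of its underlying undirected graph. An acyclic subgraph of an oriented graph is a subgraph containing no directed cycle. For an oriented graph $G$, $f(G)$ denotes the maximum chromatic number of an acyclic subgraph of $G$. For a positive integer $n$, $f(n)$ is the smallest integer such that every oriented graph $G$ with chromatic number larger than $f(n)$ satisfies $f(G) > n$. -}

module Defs where

open import Data.Nat using (ℕ; zero; suc; _≤_)
open import Data.Fin using (Fin; zero; suc; inject₁; fromℕ)
open import Data.Product using (Σ; ∃; _×_; _,_)
open import Data.Sum using (_⊎_)
open import Relation.Nullary using (¬_)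
open import Relation.Binary.PropositionalEquality using (_≡_; _≢_)
open import Function.Definitions using (Injective)

record OrientedGraph (n : ℕ) : Set₁ where
  field
    Arc   : Fin n → Fin n → Set
    irrefl : ∀ v → ¬ Arc v v
    asym   : ∀ u v → Arc u v → ¬ Arc v u
open OrientedGraph public

Adj : {n : ℕ} → (Fin n → Fin n → Set) → Fin n → Fin n → Set
Adj A u v = A u v ⊎ A v u

Colorable : {n : ℕ} → (Fin n → Fin n → Set) → ℕ → Set
Colorable {n} A k = Σ (Fin n → Fin k) λ c → ∀ u v → Adj A u v → c u ≢ c v

ChromaticNumber : {n : ℕ} → (Fin n → Fin n → Set) → ℕ → Set
ChromaticNumber A k = Colorable A k × (∀ j → Colorable A j → k ≤ j)

ChromaticGreaterThan : {n : ℕ} → (Fin n → Fin n → Set) → ℕ → Set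
ChromaticGreaterThan A m = ∀ j → Colorable A j → suc m ≤ j

Subgraph : {n : ℕ} → OrientedGraph n → (Fin n → Fin n → Set) → Set
Subgraph G H = ∀ u v → H u v → Arc G u v

-- A directed cycle: distinct vertices v_0, ..., v_{k+1} (length k+2 ≥ 2)
-- with arcs v_i → v_{i+1} and v_{k+1} → v_0.
DirectedCycle : {n : ℕ} → (Fin n → Fin n → Set) → Set
DirectedCycle {n} H =
  Σ ℕ λ k → Σ (Fin (suc (suc k)) → Fin n) λ v →
    Injective _≡_ _≡_ v
    × (∀ (i : Fin (suc k)) → H (v (inject₁ i)) (v (suc i)))
    × H (v (fromℕ (suc k))) (v zero)

Acyclic : {n : ℕ} → (Fin n → Fin n → Set) → Set
Acyclic H = ¬ DirectedCycle H

FGreaterThan : {n : ℕ} → OrientedGraph n → ℕ → Set₁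
FGreaterThan G m =
  Σ (_ → _ → Set) λ H → Subgraph G H × Acyclic H × ChromaticGreaterThan H m

FBound : ℕ → ℕ → Set₁
FBound n m = ∀ (N : ℕ) (G : OrientedGraph N) → ChromaticGreaterThan (Arc G) m → FGreaterThan G n

FValue : ℕ → ℕ → Set₁
FValue n m = FBound n m × (∀ j → FBound n j → m ≤ j)

{-# OPTIONS --safe #-}
-- Suppose every acyclic subgraph of G is 2-colourable.  We 3-colour G greedily:
-- let v be a new vertex and c a 3-colouring of the graph on the other vertices.
--
-- Two colour classes of c span a bipartite graph B, and B has an acyclic subgraph
-- F such that every 2-colouring of F is one of B (it spans the components of B).
-- Adding to F the arcs from the in-neighbours of v (or those to its
-- out-neighbours) keeps it acyclic, as v is then a sink (a source).  A 2-colouring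
-- of the result recolours B so that these neighbours all receive the same colour.
-- Colours 0 and 1 let the in-neighbours avoid 0; then colours 1 and 2 let them
-- avoid 1; now they all have colour 2, so colours 0 and 1 let the out-neighbours
-- avoid 0 without disturbing them, and v gets colour 0.
--
-- The bound f(2) ≥ 3 comes from the directed triangle.
module Submission where

open import Defs
open import Data.Nat using (ℕ; _≤_)
open import Data.Product using (Σ; _×_)

open import Data.Fin as Fin
  using (Fin; zero; suc; toℕ; inject₁; inject≤; fromℕ; opposite; punchIn;
         punchOut; combine; remQuot; finToFun; funToFin)
open import Data.Fin.Induction using () renaming (<-wellFounded to Fin-<-wellFounded)
open import Data.Fin.Properties as FinP
  using (_≟_; punchIn-injective; punchInᵢ≢i; punchOut-injective; opposite-involutive;
         inject≤-injective; injective⇒≤; remQuot-combine; finToFun-funToFin)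
open import Data.List using (List; []; _∷_; allFin; cartesianProduct)
open import Data.List.Membership.Propositional using (_∈_)
open import Data.List.Membership.Propositional.Properties using (∈-cartesianProduct⁺; ∈-allFin)
open import Data.List.Relation.Unary.Any using (here; there)
open import Data.Nat using (zero; suc; _+_; _*_; _^_; _<_; _⊔_; s≤s; s<s; z<s; _<?_)
import Data.Nat.Properties as ℕ
open import Data.Product using (∃; _,_; proj₁; proj₂; uncurry)
open import Data.Sum using (inj₁; inj₂)
open import Function using (_∘_; id)
open import Induction.WellFounded using (module All)
open import Level using (0ℓ)
open import Relation.Binary using (tri<; tri≈; tri>)
open import Relation.Binary.PropositionalEquality
  using (_≡_; _≢_; refl; sym; trans; cong; cong₂; subst; ≢-sym)
open import Relation.Nullary using (¬_; Dec; yes; no; contradiction)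
open import Relation.Nullary.Decidable using (¬¬-excluded-middle)
open import Relation.Nullary.Negation using (¬¬-Monad)
open import Effect.Monad using (RawMonad)

open RawMonad (¬¬-Monad {0ℓ}) using (_>>=_; pure)

private variable
  n : ℕ
  C : Set

-- Relations, colourings and ranks

Rel : ℕ → Set₁
Rel n = Fin n → Fin n → Set

Proper : Rel n → (Fin n → C) → Set
Proper R c = ∀ u v → R u v → c u ≢ c v

-- Acyclic subgraphs are represented by ranks: arcs that strictly increase a rank close no directed
-- cycle.
Ascending : Rel n → (Fin n → ℕ) → Rel n
Ascending R r u v = R u v × r u < r v

colorable⇒proper : {R : Rel n} {k : ℕ} → Colorable R k → Σ (Fin n → Fin k) (Proper R)
colorable⇒proper (c , p) = c , λ u v → p u v ∘ inj₁

proper⇒colorable : {R : Rel n} {k : ℕ} (c : Fin n → Fin k) → Proper R c → Colorable R k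
proper⇒colorable c p = c , λ where
  u v (inj₁ uv) → p u v uv
  u v (inj₂ vu) → ≢-sym (p v u vu)

-- Addition modulo 2 of colours

_⊕_ : Fin 2 → Fin 2 → Fin 2
zero     ⊕ y = y
suc zero ⊕ y = opposite y

⊕-self : ∀ x → x ⊕ x ≡ zero
⊕-self zero       = refl
⊕-self (suc zero) = refl

⊕-cancelˡ : ∀ x {y z} → x ⊕ y ≡ x ⊕ z → y ≡ z
⊕-cancelˡ zero       eq = eq
⊕-cancelˡ (suc zero) {y} {z} eq =
  trans (sym (opposite-involutive y)) (trans (cong opposite eq) (opposite-involutive z))

⊕-comm : ∀ x y → x ⊕ y ≡ y ⊕ x
⊕-comm zero       zero       = refl
⊕-comm zero       (suc zero) = refl
⊕-comm (suc zero) zero       = refl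
⊕-comm (suc zero) (suc zero) = refl

⊕-cancelʳ : ∀ x {y z} → y ⊕ x ≡ z ⊕ x → y ≡ z
⊕-cancelʳ x {y} {z} eq = ⊕-cancelˡ x (trans (⊕-comm x y) (trans eq (⊕-comm z x)))

≢⇒≡opposite : ∀ {x y : Fin 2} → x ≢ y → x ≡ opposite y
≢⇒≡opposite {zero}     {zero}     x≢y = contradiction refl x≢y
≢⇒≡opposite {zero}     {suc zero} x≢y = refl
≢⇒≡opposite {suc zero} {zero}     x≢y = refl
≢⇒≡opposite {suc zero} {suc zero} x≢y = contradiction refl x≢y

opposite-⊕-opposite : ∀ x y → opposite x ⊕ opposite y ≡ x ⊕ y
opposite-⊕-opposite zero       zero       = refl
opposite-⊕-opposite zero       (suc zero) = refl
opposite-⊕-opposite (suc zero) zero       = refl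
opposite-⊕-opposite (suc zero) (suc zero) = refl

-- Two proper 2-colourings both flip along an arc, so their sum does not change.
≢-⊕-≢ : ∀ {x x′ y y′} → x ≢ x′ → y ≢ y′ → x ⊕ y ≡ x′ ⊕ y′
≢-⊕-≢ {x′ = x′} {y′ = y′} x≢x′ y≢y′ =
  trans (cong₂ _⊕_ (≢⇒≡opposite x≢x′) (≢⇒≡opposite y≢y′)) (opposite-⊕-opposite x′ y′)

-- Bipartite graphs

bounded : (r : Fin n → ℕ) → ∃ λ K → ∀ x → r x < K
bounded {zero}  r = 0 , λ ()
bounded {suc n} r with bounded (r ∘ suc)
... | K , r<K = suc (r zero) ⊔ K , λ where
  zero    → ℕ.m≤m⊔n (suc (r zero)) K
  (suc x) → ℕ.≤-trans (r<K x) (ℕ.m≤n⊔m (suc (r zero)) K)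

-- If the colouring b′ gives u and v the same colour, the sum of b and b′ is
-- constant along the ascending arcs but differs at u and v, so raising the ranks of
-- one of its two classes makes the arc u → v ascending and keeps the others so.
addArc : (B : Rel n) (b : Fin n → Fin 2) → Proper B b → (r : Fin n → ℕ) →
  ∀ {u v} → B u v → (b′ : Fin n → Fin 2) → Proper (Ascending B r) b′ → b′ u ≡ b′ v →
  Σ (Fin n → ℕ) λ r′ → r′ u < r′ v × (∀ x y → Ascending B r x y → r′ x < r′ y)
addArc {n} B b b-proper r {u} {v} Buv b′ b′-proper b′u≡b′v with bounded r
... | K , r<K = r′ , r′u<r′v , keeps
  where
  side : Fin n → Fin 2
  side x = (b u ⊕ b′ u) ⊕ (b x ⊕ b′ x)

  r′ : Fin n → ℕ
  r′ x = toℕ (side x) * K + r x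

  side-u : side u ≡ zero
  side-u = ⊕-self (b u ⊕ b′ u)

  side-v : side v ≡ suc zero
  side-v = ≢⇒≡opposite λ side-v≡0 → b-proper u v Buv (sym (⊕-cancelʳ (b′ v)
    (trans (⊕-cancelˡ (b u ⊕ b′ u) (trans side-v≡0 (sym side-u))) (cong (b u ⊕_) b′u≡b′v))))

  r′u<r′v : r′ u < r′ v
  r′u<r′v rewrite side-u | side-v =
    ℕ.<-≤-trans (r<K u) (ℕ.≤-trans (ℕ.m≤m+n K 0) (ℕ.m≤m+n (K + 0) (r v)))

  keeps : ∀ x y → Ascending B r x y → r′ x < r′ y
  keeps x y xy@(Bxy , rx<ry)
    rewrite ≢-⊕-≢ (b-proper x y Bxy) (b′-proper x y xy) =
    ℕ.+-monoʳ-< (toℕ (side y) * K) rx<ry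

Forces : Rel n → (Fin n → ℕ) → Fin n → Fin n → Set
Forces B r u v = ∀ (b : Fin _ → Fin 2) → Proper (Ascending B r) b → B u v → b u ≢ b v

-- Pairs are treated one at a time. If a pair is not yet forced, some 2-colouring gives its ends the
-- same colour, and `addArc` makes its arc ascend; earlier ascending arcs survive, so earlier pairs
-- stay forced. The case split is made under double negation, as `B` need not be decidable.
forcingOrder-on : (B : Rel n) (b : Fin n → Fin 2) → Proper B b → (L : List (Fin n × Fin n)) →
  ¬ ¬ Σ (Fin n → ℕ) λ r → ∀ {u v} → (u , v) ∈ L → Forces B r u v
forcingOrder-on B b b-proper [] = pure ((λ _ → 0) , λ ())
forcingOrder-on {n} B b b-proper ((u , v) ∷ L) = do
  r , forces ← forcingOrder-on B b b-proper L
  em ← ¬¬-excluded-middle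
  pure (extend r forces em)
  where
  extend : (r : Fin n → ℕ) → (∀ {x y} → (x , y) ∈ L → Forces B r x y) →
    Dec (B u v × Σ (Fin n → Fin 2) λ b′ → Proper (Ascending B r) b′ × b′ u ≡ b′ v) →
    Σ (Fin n → ℕ) λ r → ∀ {x y} → (x , y) ∈ (u , v) ∷ L → Forces B r x y
  extend r forces (no ¬p) = r , λ where
    (here refl) b′ b′-proper Buv b′u≡b′v → ¬p (Buv , b′ , b′-proper , b′u≡b′v)
    (there m) → forces m
  extend r forces (yes (Buv , b′ , b′-proper , b′u≡b′v))
    with addArc B b b-proper r Buv b′ b′-proper b′u≡b′v
  ... | r′ , r′u<r′v , keeps = r′ , λ where
    (here refl) b″ b″-proper Buv → b″-proper u v (Buv , r′u<r′v)
    (there m) b″ b″-proper →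
      forces m b″ λ x y xy → b″-proper x y (proj₁ xy , keeps x y xy)

forcingOrder : (B : Rel n) (b : Fin n → Fin 2) → Proper B b →
  ¬ ¬ Σ (Fin n → ℕ) λ r → (b′ : Fin n → Fin 2) → Proper (Ascending B r) b′ → Proper B b′
forcingOrder {n} B b b-proper = do
  r , forces ← forcingOrder-on B b b-proper (cartesianProduct (allFin n) (allFin n))
  pure (r , λ b′ b′-proper u v →
    forces (∈-cartesianProduct⁺ (∈-allFin u) (∈-allFin v)) b′ b′-proper)

-- Recolouring

-- With two colours, avoiding `zero` means that all of `W` receives the same colour.
Alignable : Rel n → (Fin n → Set) → Set
Alignable {n} R W = (r : Fin n → ℕ) →
  ¬ ¬ Σ (Fin n → Fin 2) λ b → Proper (Ascending R r) b × (∀ x → W x → b x ≢ zero)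

-- Junk value: forget e e is zero.
forget : Fin 3 → Fin 3 → Fin 2
forget e i with e ≟ i
... | yes _   = zero
... | no  e≢i = punchOut e≢i

forget-injective : ∀ e {i j} → e ≢ i → e ≢ j → forget e i ≡ forget e j → i ≡ j
forget-injective e {i} {j} e≢i e≢j eq with e ≟ i | e ≟ j
... | yes e≡i | _       = contradiction e≡i e≢i
... | no _    | yes e≡j = contradiction e≡j e≢j
... | no e≢i′ | no e≢j′ = punchOut-injective e≢i′ e≢j′ eq

-- The class of `e` stays fixed and `b` recolours the other two, so gains of earlier calls that
-- concern colour `e` survive later ones.
recolour : (R : Rel n) (W : Fin n → Set) → Alignable R W →
  (c : Fin n → Fin 3) → Proper R c → (e : Fin 3) →
  ¬ ¬ Σ (Fin n → Fin 3) λ c′ → Proper R c′ × (∀ x → W x → c′ x ≢ punchIn e zero)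
    × (∀ x → c x ≡ e → c′ x ≡ e) × (∀ x → c x ≢ e → c′ x ≢ e)
recolour {n} R W align c c-proper e = do
  r , forces ← forcingOrder B (forget e ∘ c) B-proper
  b , b-proper , b-W ← align r
  -- Ascending arcs of `B` are ascending arcs of `R`, so `b` is proper on them, and `forces` extends
  -- this to all of `B`.
  let module N = New b (forces b λ { u v ((Ruv , _) , u<v) → b-proper u v (Ruv , u<v) }) b-W
  pure (N.c′ , N.c′-proper , N.c′-W , N.old , N.new)
  where
  B : Rel n
  B u v = R u v × e ≢ c u × e ≢ c v

  B-proper : Proper B (forget e ∘ c)
  B-proper u v (Ruv , e≢cu , e≢cv) eq = c-proper u v Ruv (forget-injective e e≢cu e≢cv eq)

  module New (b : Fin n → Fin 2) (b-proper : Proper B b) (b-W : ∀ x → W x → b x ≢ zero) where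

    c′ : Fin n → Fin 3
    c′ x with e ≟ c x
    ... | yes _ = e
    ... | no  _ = punchIn e (b x)

    c′-proper : Proper R c′
    c′-proper u v Ruv with e ≟ c u | e ≟ c v
    ... | yes e≡cu | yes e≡cv = λ _ → c-proper u v Ruv (trans (sym e≡cu) e≡cv)
    ... | yes _    | no _     = punchInᵢ≢i e (b v) ∘ sym
    ... | no _     | yes _    = punchInᵢ≢i e (b u)
    ... | no e≢cu  | no e≢cv  =
      b-proper u v (Ruv , e≢cu , e≢cv) ∘ punchIn-injective e (b u) (b v)

    c′-W : ∀ x → W x → c′ x ≢ punchIn e zero
    c′-W x Wx with e ≟ c x
    ... | yes _ = punchInᵢ≢i e zero ∘ sym
    ... | no _  = b-W x Wx ∘ punchIn-injective e (b x) zero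

    old : ∀ x → c x ≡ e → c′ x ≡ e
    old x cx≡e with e ≟ c x
    ... | yes _   = refl
    ... | no e≢cx = contradiction (sym cx≡e) e≢cx

    new : ∀ x → c x ≢ e → c′ x ≢ e
    new x cx≢e with e ≟ c x
    ... | yes e≡cx = contradiction (sym e≡cx) cx≢e
    ... | no _     = punchInᵢ≢i e (b x)

-- Three colours suffice

-- The assumption to be refuted: every acyclic subgraph is 2-colourable, up to double negation.
Bipartitions : Rel n → Set
Bipartitions {n} R = (r : Fin n → ℕ) → ¬ ¬ Σ (Fin n → Fin 2) (Proper (Ascending R r))

module Step (R : Rel (suc n)) (bip : Bipartitions R) where

  R⁻ : Rel n
  R⁻ x y = R (suc x) (suc y)

  In Out : Fin n → Set
  In  x = R (suc x) zero
  Out x = R zero (suc x)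

  -- The shift by `b zero` moves the colour of the new vertex to `zero`.
  align : (b : Fin (suc n) → Fin 2) → Fin n → Fin 2
  align b x = b zero ⊕ b (suc x)

  align-≢zero : ∀ b {x} → b (suc x) ≢ b zero → align b x ≢ zero
  align-≢zero b ≢ eq = ≢ (⊕-cancelˡ (b zero) (trans eq (sym (⊕-self (b zero)))))

  alignIn : Alignable R⁻ In
  alignIn r with bounded r
  ... | K , r<K = do
    -- Rank `K` exceeds all others, so every arc into the new vertex ascends.
    b , b-proper ← bip λ { zero → K ; (suc x) → r x }
    pure (align b
      , (λ u v (Ruv , u<v) → b-proper (suc u) (suc v) (Ruv , u<v) ∘ ⊕-cancelˡ (b zero))
      , (λ x Rx0 → align-≢zero b (b-proper (suc x) zero (Rx0 , r<K x))))

  alignOut : Alignable R⁻ Out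
  alignOut r = do
    -- The shift by one leaves rank 0 to the new vertex alone, so every arc out of it ascends.
    b , b-proper ← bip λ { zero → 0 ; (suc x) → suc (r x) }
    pure (align b
      , (λ u v (Ruv , u<v) → b-proper (suc u) (suc v) (Ruv , s<s u<v) ∘ ⊕-cancelˡ (b zero))
      , (λ x R0x → align-≢zero b (≢-sym (b-proper zero (suc x) (R0x , z<s)))))

  bip⁻ : Bipartitions R⁻
  bip⁻ r = do
    b , b-proper , _ ← alignIn r
    pure (b , b-proper)

  freeColour : (c : Fin n → Fin 3) → Proper R⁻ c →
    ¬ ¬ Σ (Fin n → Fin 3) λ c′ → Proper R⁻ c′ × (∀ x → In x → c′ x ≢ zero)
      × (∀ x → Out x → c′ x ≢ zero)
  freeColour c c-proper = do
    -- The avoided colour `punchIn e zero` is 0 for `e` = 2 and 1 for `e` = 0.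
    c₁ , proper₁ , in≢0 , _ ← recolour R⁻ In alignIn c c-proper (suc (suc zero))
    c₂ , proper₂ , in≢1 , _ , keep≢0 ← recolour R⁻ In alignIn c₁ proper₁ zero
    c₃ , proper₃ , out≢0 , keep≡2 , _ ← recolour R⁻ Out alignOut c₂ proper₂ (suc (suc zero))
    pure (c₃ , proper₃
      , (λ x Ix c₃x≡0 → contradiction
          (trans (sym c₃x≡0) (keep≡2 x (only2 (keep≢0 x (in≢0 x Ix)) (in≢1 x Ix)))) λ ())
      , out≢0)
    where
    only2 : ∀ {i : Fin 3} → i ≢ zero → i ≢ suc zero → i ≡ suc (suc zero)
    only2 {zero}         i≢0 _   = contradiction refl i≢0
    only2 {suc zero}     _   i≢1 = contradiction refl i≢1
    only2 {suc (suc zero)} _ _   = refl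

threeColouring : (R : Rel n) → (∀ v → ¬ R v v) → Bipartitions R →
  ¬ ¬ Σ (Fin n → Fin 3) (Proper R)
threeColouring {zero}  R irr bip = pure ((λ ()) , λ ())
threeColouring {suc n} R irr bip = do
  c , c-proper ← threeColouring R⁻ (irr ∘ suc) bip⁻
  c′ , c′-proper , in≢0 , out≢0 ← freeColour c c-proper
  pure ((λ { zero → zero ; (suc x) → c′ x }) , λ where
    zero    zero    R00 → contradiction R00 (irr zero)
    zero    (suc y) R0y → ≢-sym (out≢0 y R0y)
    (suc x) zero    Rx0 → in≢0 x Rx0
    (suc x) (suc y) Rxy → c′-proper x y Rxy)
  where open Step R bip

-- Acyclic subgraphs

chain-≤ : ∀ k (w : Fin (suc k) → ℕ) → (∀ i → w (inject₁ i) < w (suc i)) →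
  w zero ≤ w (fromℕ k)
chain-≤ zero    w asc = ℕ.≤-refl
chain-≤ (suc k) w asc =
  ℕ.≤-trans (ℕ.<⇒≤ (asc zero)) (chain-≤ k (w ∘ suc) (asc ∘ suc))

Least : {m : ℕ} → (Fin m → Set) → Fin m → Set
Least P i = P i × (∀ j → j Fin.< i → ¬ P j)

Least-unique : ∀ {m} {P : Fin m → Set} {i j} → Least P i → Least P j → i ≡ j
Least-unique {i = i} {j} (Pi , ¬<i) (Pj , ¬<j) with FinP.<-cmp i j
... | tri< i<j _ _ = contradiction Pi (¬<j i i<j)
... | tri≈ _ i≡j _ = i≡j
... | tri> _ _ j<i = contradiction Pj (¬<i j j<i)

-- If no element is least, well-founded induction refutes `P` everywhere.
¬¬-least : ∀ {m} {P : Fin m → Set} i → P i → ¬ ¬ ∃ (Least P)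
¬¬-least {P = P} i Pi none =
  wfRec (¬_ ∘ P) (λ j below Pj → none (j , Pj , λ k k<j → below k<j)) i Pi
  where open All Fin-<-wellFounded 0ℓ

-- The least code of a good relation is unique, so a subgraph can be selected
-- although neither adjacency nor goodness is decidable.
module Select (A : Rel n) where

  decode : Fin (2 ^ (n * n)) → Rel n
  decode m u v = finToFun m (combine u v) ≡ suc zero

  bit : (Fin n → ℕ) → Fin n → Fin n → Fin 2
  bit r u v with r u <? r v
  ... | yes _ = suc zero
  ... | no  _ = zero

  code : (Fin n → ℕ) → Fin (2 ^ (n * n))
  code r = funToFin (uncurry (bit r) ∘ remQuot n)

  decode-code : ∀ r u v → finToFun (code r) (combine u v) ≡ bit r u v
  decode-code r u v = trans
    (finToFun-funToFin (uncurry (bit r) ∘ remQuot n) (combine u v))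
    (cong (uncurry (bit r)) (remQuot-combine u v))

  code-sound : ∀ r u v → decode (code r) u v → r u < r v
  code-sound r u v uv with r u <? r v | trans (sym (decode-code r u v)) uv
  ... | yes u<v | _ = u<v

  code-complete : ∀ r u v → r u < r v → decode (code r) u v
  code-complete r u v u<v with r u <? r v | decode-code r u v
  ... | yes _  | eq = eq
  ... | no u≮v | _  = contradiction u<v u≮v

  Good : Fin (2 ^ (n * n)) → Set
  Good m = Σ (Fin n → ℕ) (λ r → ∀ u v → decode m u v → r u < r v)
    × (∀ (b : Fin n → Fin 2) → ¬ Proper (λ u v → A u v × decode m u v) b)

  H : Rel n
  H u v = A u v × Σ (Fin (2 ^ (n * n))) λ m → Least Good m × decode m u v

  -- Every arc carries a least good code. These coincide, so the rank supplied with the closing arc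
  -- increases around the whole cycle.
  H-acyclic : Acyclic H
  H-acyclic (k , w , _ , arcs , (_ , m , least@(((r , asc) , _) , _) , close)) =
    ℕ.<⇒≱ (asc _ _ close) (chain-≤ (suc k) (r ∘ w) λ i → ascends (arcs i))
    where
    ascends : ∀ {u v} → H u v → r u < r v
    ascends {u} {v} (_ , m′ , least′ , uv) =
      asc u v (subst (λ m → decode m u v) (Least-unique least′ least) uv)

  -- The goal is a negation, so a least good code may be assumed; all its arcs lie in `H`, and they
  -- admit no proper 2-colouring.
  H-not-2-colorable : ¬ ¬ Σ (Fin n → ℕ) (λ r → ∀ (b : Fin n → Fin 2) → ¬ Proper (Ascending A r) b) →
    ¬ Colorable H 2
  H-not-2-colorable ex colorable with colorable⇒proper colorable
  ... | b , b-proper = (do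
      r , bad ← ex
      m , least@((_ , bad-m) , _) ← ¬¬-least {P = Good} (code r)
        ((r , code-sound r)
        , λ b b-proper → bad b λ u v (Auv , u<v) → b-proper u v (Auv , code-complete r u v u<v))
      pure (bad-m b λ u v (Auv , uv) → b-proper u v (Auv , m , least , uv)))
    id

Colorable-mono : {R : Rel n} {j k : ℕ} → j ≤ k → Colorable R j → Colorable R k
Colorable-mono j≤k (c , p) =
  (λ x → inject≤ (c x) j≤k) , λ u v uv → p u v uv ∘ inject≤-injective j≤k j≤k (c u) (c v)

¬2-colorable⇒3≤ : {R : Rel n} → ¬ Colorable R 2 → ∀ j → Colorable R j → 3 ≤ j
¬2-colorable⇒3≤ ¬2 j col = ℕ.≮⇒≥ λ { (s≤s j≤2) → ¬2 (Colorable-mono j≤2 col) }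

acyclicSubgraph : FBound 2 3
acyclicSubgraph N G χ>3 =
  H , (λ u v → proj₁) , H-acyclic , ¬2-colorable⇒3≤ (H-not-2-colorable badOrder)
  where
  open Select (Arc G)

  badOrder : ¬ ¬ Σ (Fin N → ℕ) λ r → ∀ (b : Fin N → Fin 2) → ¬ Proper (Ascending (Arc G) r) b
  badOrder none = threeColouring (Arc G) (irrefl G)
    -- With no bad rank, every rank has a 2-colouring up to double negation, which is
    -- `Bipartitions`.
    (λ r ¬2 → none (r , λ b b-proper → ¬2 (b , b-proper)))
    λ (c , c-proper) → ℕ.n≮n 3 (χ>3 3 (proper⇒colorable c c-proper))

-- The directed triangle

next : Fin 3 → Fin 3
next zero             = suc zero
next (suc zero)       = suc (suc zero)
next (suc (suc zero)) = zero

triangle : OrientedGraph 3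
triangle = record { Arc = λ u v → next u ≡ v ; irrefl = irr ; asym = λ { u _ refl → asy u } }
  where
  irr : ∀ v → next v ≢ v
  irr zero             ()
  irr (suc zero)       ()
  irr (suc (suc zero)) ()

  asy : ∀ u → next (next u) ≢ u
  asy zero             ()
  asy (suc zero)       ()
  asy (suc (suc zero)) ()

triangle-3≤ : ∀ j → Colorable (Arc triangle) j → 3 ≤ j
triangle-3≤ j (c , p) = injective⇒≤ λ {u} {v} → inj u v
  where
  inj : ∀ u v → c u ≡ c v → u ≡ v
  inj zero             zero             _  = refl
  inj zero             (suc zero)       eq = contradiction eq (p _ _ (inj₁ refl))
  inj zero             (suc (suc zero)) eq = contradiction eq (p _ _ (inj₂ refl))
  inj (suc zero)       zero             eq = contradiction eq (p _ _ (inj₂ refl))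
  inj (suc zero)       (suc zero)       _  = refl
  inj (suc zero)       (suc (suc zero)) eq = contradiction eq (p _ _ (inj₁ refl))
  inj (suc (suc zero)) zero             eq = contradiction eq (p _ _ (inj₁ refl))
  inj (suc (suc zero)) (suc zero)       eq = contradiction eq (p _ _ (inj₂ refl))
  inj (suc (suc zero)) (suc (suc zero)) _  = refl

-- Without one of its arcs the triangle is 2-colourable, so `H` would contain all three and be a
-- directed cycle.
triangle-¬FGreaterThan : ¬ FGreaterThan triangle 2
triangle-¬FGreaterThan (H , sub , acyclic , χ>2) = (do
    h₀ ← present zero
    h₁ ← present (suc zero)
    h₂ ← present (suc (suc zero))
    pure (acyclic (1 , id , id , (λ { zero → h₀ ; (suc zero) → h₁ }) , h₂)))
  id
  where
  present : ∀ i → ¬ ¬ H i (next i)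
  present i ¬h = ℕ.n≮n 2 (χ>2 2 (proper⇒colorable (c i) (c-proper i ¬h)))
    where
    -- The ends of the missing arc share colour `zero`; the third vertex, `next (next i)`, gets the
    -- other colour.
    c : Fin 3 → Fin 3 → Fin 2
    c i x with x ≟ next (next i)
    ... | yes _ = suc zero
    ... | no  _ = zero

    c-proper : ∀ i → ¬ H i (next i) → Proper H (c i)
    c-proper i ¬h u v uv with sub u v uv
    c-proper zero             ¬h zero             _ uv | refl = contradiction uv ¬h
    c-proper zero             ¬h (suc zero)       _ uv | refl = λ ()
    c-proper zero             ¬h (suc (suc zero)) _ uv | refl = λ ()
    c-proper (suc zero)       ¬h zero             _ uv | refl = λ ()
    c-proper (suc zero)       ¬h (suc zero)       _ uv | refl = contradiction uv ¬h
    c-proper (suc zero)       ¬h (suc (suc zero)) _ uv | refl = λ ()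
    c-proper (suc (suc zero)) ¬h zero             _ uv | refl = λ ()
    c-proper (suc (suc zero)) ¬h (suc zero)       _ uv | refl = λ ()
    c-proper (suc (suc zero)) ¬h (suc (suc zero)) _ uv | refl = contradiction uv ¬h

f2≥3 : ∀ j → FBound 2 j → 3 ≤ j
f2≥3 j bound = ℕ.≮⇒≥ λ j<3 →
  triangle-¬FGreaterThan (bound 3 triangle λ i col → ℕ.≤-trans j<3 (triangle-3≤ i col))

theorem1p5 : ((N : ℕ) (G : OrientedGraph N) → ChromaticNumber (Arc G) 4 →
    Σ (_ → _ → Set) λ H → Subgraph G H × Acyclic H × (∀ j → Colorable H j → 3 ≤ j))
    × FValue 2 3
-- The minimality half of chromatic number 4 is by definition `ChromaticGreaterThan (Arc G) 3`.
theorem1p5 = (λ N G χ≡4 → acyclicSubgraph N G (proj₂ χ≡4)) , acyclicSubgraph , f2≥3
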